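{- For any $\varepsilon>0$ and $N=O\left(\frac{n^2}{\varepsilon}\right)\uparrow\uparrow(n-1)$, there exists a distribution $\mathcal{F}_n(\varepsilon)$ over $n$-element sets $S\subseteq[N]$ such that, for $S\sim\mathcal{F}_n(\varepsilon)$, $$d_{\mathsf{TV}}(S_I,S_J)\le\varepsilon\qquad\text{for all } I,J\subseteq[n]\text{ with }|I|=|J|.$$ (This is called the order statistics indistinguishable, or OSI, property.)
   Context: $[m]=\{1,\dots,m\}$. $a\uparrow\uparrow b=a^{a^{\cdots^{a}}}$ ($b$ copies of $a$) is Knuth's up-arrow notation for iterated exponentiation. For an $n$-element set $S=\{s_1<s_2<\dots<s_n\}$ of integers and an index set $I\subseteq[n]$, $S_I=\{s_k: k\in I\}$. For discrete random objects $X,Y$ with probability mass functions $p_X,p_Y$ on a common discrete domain $\mathcal{T}$, the total variation distance is $d_{\mathsf{TV}}(X,Y)=\frac12\sum_{t\in\mathcal{T}}|p_X(t)-p_Y(t)|$; in the claim $S_I$ and $S_J$ are viewed as random sets when $S\sim\mathcal{F}_n(\varepsilon)$. -}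

module Defs where

open import Data.Bool.Base using (if_then_else_)
import Data.Bool.Properties as Bool
open import Data.Fin.Subset using (Subset; inside; outside; ∣_∣)
import Data.Integer.Base as ℤ
open import Data.Nat.Base as ℕ using (ℕ; zero; suc)
open import Data.Rational.Base as ℚ
  using (ℚ; 0ℚ; 1ℚ; ½; Positive; ceiling)
open import Data.Rational.Properties using (pos⇒nonZero)
open import Data.Vec.Base using ([]; _∷_)
open import Data.Vec.Properties using (≡-dec)
open import Relation.Binary.Definitions using (DecidableEquality)
open import Relation.Binary.PropositionalEquality using (_≡_; _≢_)
open import Relation.Nullary.Decidable.Core using (does)

infixr 9 _↑↑_

_↑↑_ : ℕ → ℕ → ℕ
a ↑↑ zero  = 1
a ↑↑ suc b = a ℕ.^ (a ↑↑ b)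

-- ⌈ n² / ε ⌉ as a natural number (the ceiling is nonnegative because ε > 0).
-- A base of order O(n²/ε) is a constant multiple of this number: rounding up
-- at most doubles n²/ε as long as ε ≤ n², and beyond that range it keeps the
-- base at least 1, so that a constant factor can still make room for an
-- n-element set.
⌈_²/_⌉ : (n : ℕ) (ε : ℚ) .{{_ : Positive ε}} → ℕ
⌈ n ²/ ε ⌉ = ℤ.∣ ceiling (ℚ._÷_ (ℤ.+ (n ℕ.* n) ℚ./ 1) ε {{pos⇒nonZero ε}}) ∣

_≟ₛ_ : ∀ {N} → DecidableEquality (Subset N)
_≟ₛ_ = ≡-dec Bool._≟_

-- Sum over all 2^N subsets.
∑ : ∀ {N} → (Subset N → ℚ) → ℚ
∑ {zero}  f = f []
∑ {suc N} f = ∑ (λ S → f (outside ∷ S)) ℚ.+ ∑ (λ S → f (inside ∷ S))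

-- A probability distribution over the n-element subsets of [N], given as a
-- mass function on all subsets that vanishes off the n-element ones.
-- The set [N] = {1 < … < N} is represented by Fin N, shifted down by one.
record Distribution (n N : ℕ) : Set where
  field
    pmf     : Subset N → ℚ
    nonneg  : ∀ S → 0ℚ ℚ.≤ pmf S
    total   : ∑ pmf ≡ 1ℚ
    support : ∀ S → pmf S ≢ 0ℚ → ∣ S ∣ ≡ n

open Distribution public

-- select S I is S_I = { s_k : k ∈ I } for S = { s_1 < s_2 < … }: scanning [N]
-- upwards, the k-th element of S that is met is kept exactly when k ∈ I.
-- If S has more than n elements, the ones after s_n are dropped; a sample of
-- a Distribution n N never has any.
select : ∀ {N n} → Subset N → Subset n → Subset N
select []            I       = []
select (outside ∷ S) I       = outside ∷ select S I
select (inside  ∷ S) []      = outside ∷ select S []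
select (inside  ∷ S) (i ∷ I) = i ∷ select S I

-- The probability mass function of S_I for S ∼ F.
orderStatistics : ∀ {n N} → Distribution n N → Subset n → Subset N → ℚ
orderStatistics F I T =
  ∑ λ S → if does (select S I ≟ₛ T) then pmf F S else 0ℚ

dTV : ∀ {N} → (p q : Subset N → ℚ) → ℚ
dTV p q = ½ ℚ.* ∑ λ T → ℚ.∣ p T ℚ.- q T ∣

{-# OPTIONS --safe #-}

-- A set D of exponents is spread out to a set S with one more element: the
-- smallest element of S is uniform in an interval of length about bᴺ / 2, and
-- its successive gaps are uniform in [bᵉ], for e ∈ D in increasing order.  The
-- sum of two successive gaps is dominated by the second one, so it is within
-- O(1/b) of the second one alone; deleting an element of S therefore has the
-- same effect, up to O(1/b), as deleting one exponent from D.  So S_I is close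
-- to the spread of D_{I′}, where I′ is I without its first element, and if the
-- distribution of D satisfies the OSI property with error e, then that of S
-- does with error e + O(n/b).  Starting from the empty set and iterating n
-- times gives the total error O(n²/b) inside b ↑↑ (n − 1).
--
-- Distances are measured by expectations of test functions with |f| ≤ 1, for
-- which every error comes from shifting a uniform variable (avg-shift).
module Submission where

open import Defs
open import Algebra.Bundles using (CommutativeRing)
open import Data.Bool.Base using (if_then_else_; true; false)
open import Data.Fin.Base using (Fin; zero; suc; toℕ)
open import Data.Fin.Properties using (toℕ<n)
open import Data.Fin.Subset using (Subset; inside; outside; ∣_∣; ⊥)
import Data.Integer.Base as ℤ
open import Data.Integer.DivMod using ([n/d]*d≤n)
import Data.Integer.Properties as ℤP
open import Data.List.Base using (List; []; _∷_; length)
open import Data.Nat.Base as ℕ using (ℕ; zero; suc; NonZero; _*_; _∸_)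
import Data.Nat.Properties as ℕP
import Data.Nat.Solver as ℕSolver
open import Data.Product.Base as Product using (Σ-syntax; _,_; proj₁; proj₂)
open import Data.Rational.Base as ℚ
  using (ℚ; 0ℚ; 1ℚ; ½; Positive; ceiling; floor; _≤_; _+_; -_; _-_; _/_)
import Data.Rational.Properties as ℚP
open import Data.Rational.Solver using (module +-*-Solver)
import Data.Rational.Unnormalised.Base as ℚᵘ
import Data.Rational.Unnormalised.Properties as ℚᵘP
open import Data.Sum.Base using (inj₁; inj₂)
open import Data.Vec.Base using ([]; _∷_)
open import Function.Base using (_∘_; _$_; id)
open import Relation.Binary.PropositionalEquality
open import Relation.Nullary.Decidable using (does; yes; no; decidable-stable)
open import Relation.Nullary.Negation.Core using (contradiction; ¬_)
open import Algebra.Properties.CommutativeMonoid.Sum ℚP.+-0-commutativeMonoid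
  using (sum; sum-cong-≗; sum-replicate; ∑-distrib-+; ∑-comm)
open import Algebra.Properties.Monoid.Mult ℚP.+-0-monoid
  using (_×_; ×-homo-+; ×-assocˡ)
open import Algebra.Properties.Semiring.Mult
  (CommutativeRing.semiring ℚP.+-*-commutativeRing)
  using (×-assoc-*)
open import Algebra.Properties.Semiring.Sum
  (CommutativeRing.semiring ℚP.+-*-commutativeRing)
  using (*-distribˡ-sum; *-distribʳ-sum)

-- Natural multiples and unit fractions in ℚ.

+-nonNegˡ : ∀ {p q} → 0ℚ ≤ q → p ≤ p + q
+-nonNegˡ {p} 0≤q = ℚP.≤-trans (ℚP.≤-reflexive (sym (ℚP.+-identityʳ p))) (ℚP.+-monoʳ-≤ p 0≤q)

×-nonNeg : ∀ k {x} → 0ℚ ≤ x → 0ℚ ≤ k × x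
×-nonNeg zero    0≤x = ℚP.≤-refl
×-nonNeg (suc k) 0≤x = ℚP.≤-trans 0≤x (+-nonNegˡ (×-nonNeg k 0≤x))

×-monoˡ : ∀ {j k x} → 0ℚ ≤ x → j ℕ.≤ k → j × x ≤ k × x
×-monoˡ {k = k} 0≤x ℕ.z≤n       = ×-nonNeg k 0≤x
×-monoˡ {x = x} 0≤x (ℕ.s≤s j≤k) = ℚP.+-monoʳ-≤ x (×-monoˡ 0≤x j≤k)

×-as-* : ∀ k x → k × x ≡ (ℤ.+ k / 1) ℚ.* x
×-as-* zero    x = sym (ℚP.*-zeroˡ x)
×-as-* (suc k) x = begin
  x + k × x                             ≡⟨ cong₂ _+_ (sym (ℚP.*-identityˡ x)) (×-as-* k x) ⟩
  1ℚ ℚ.* x + (ℤ.+ k / 1) ℚ.* x          ≡⟨ ℚP.*-distribʳ-+ x 1ℚ (ℤ.+ k / 1) ⟨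
  (1ℚ + ℤ.+ k / 1) ℚ.* x                ≡⟨ cong (ℚ._* x) 1+k ⟩
  (ℤ.+ suc k / 1) ℚ.* x                 ∎
  where
  open ≡-Reasoning
  1+k : 1ℚ + ℤ.+ k / 1 ≡ ℤ.+ suc k / 1
  -- Values of `_/_` are reduced to lowest terms, so the identity is checked on unnormalised
  -- fractions, where addition computes.
  1+k = ℚP.toℚᵘ-injective (ℚᵘP.≃-trans (ℚP.toℚᵘ-homo-+ 1ℚ (ℤ.+ k / 1))
    (ℚᵘP.≃-trans (ℚᵘP.+-cong (ℚᵘP.≃-refl {ℚᵘ.1ℚᵘ}) (ℚP.toℚᵘ-fromℚᵘ (ℚᵘ.mkℚᵘ (ℤ.+ k) 0)))
    (ℚᵘP.≃-trans (ℚᵘ.*≡* (cong (λ i → (ℤ.1ℤ ℤ.+ i) ℤ.* ℤ.1ℤ) (ℤP.*-identityʳ (ℤ.+ k))))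
      (ℚᵘP.≃-sym (ℚP.toℚᵘ-fromℚᵘ (ℚᵘ.mkℚᵘ (ℤ.+ suc k) 0))))))

unit : ∀ K .{{_ : NonZero K}} → ℚ
unit K = ℤ.+ 1 / K

unit-nonNeg : ∀ K .{{_ : NonZero K}} → 0ℚ ≤ unit K
unit-nonNeg K = ℚP.nonNegative⁻¹ (unit K) {{ℚP.normalize-nonNeg 1 K}}

×-unit : ∀ K .{{_ : NonZero K}} → K × unit K ≡ 1ℚ
×-unit (suc k) = trans (×-as-* (suc k) (unit (suc k))) $
  ℚP.toℚᵘ-injective (ℚᵘP.≃-trans (ℚP.toℚᵘ-homo-* (ℤ.+ suc k / 1) (unit (suc k)))
    (ℚᵘP.≃-trans (ℚᵘP.*-cong (ℚP.toℚᵘ-fromℚᵘ (ℚᵘ.mkℚᵘ (ℤ.+ suc k) 0)) (ℚP.toℚᵘ-fromℚᵘ (ℚᵘ.mkℚᵘ (ℤ.+ 1) k)))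
      (ℚᵘ.*≡* (trans (ℤP.*-identityʳ _) (trans (ℤP.*-comm (ℤ.+ suc k) (ℤ.+ 1)) (cong (λ x → ℤ.1ℤ ℤ.* ℤ.+ x) (sym (ℕP.*-identityˡ (suc k)))))))))

×-*-comm : ∀ k x y → k × (x ℚ.* y) ≡ (k × x) ℚ.* y
×-*-comm k x y = sym (×-assoc-* k x y)

×-unit-≤ : ∀ m c K .{{_ : NonZero c}} .{{_ : NonZero K}} →
           c * m ℕ.≤ K → m × unit K ≤ unit c
×-unit-≤ m c K cm≤K = begin
  m × unit K                            ≡⟨ ℚP.*-identityˡ _ ⟨
  1ℚ ℚ.* (m × unit K)                   ≡⟨ cong (ℚ._* (m × unit K)) (×-unit c) ⟨
  (c × unit c) ℚ.* (m × unit K)         ≡⟨ ×-*-comm c _ _ ⟨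
  c × (unit c ℚ.* (m × unit K))         ≡⟨ cong (c ×_) (ℚP.*-comm (unit c) _) ⟩
  c × ((m × unit K) ℚ.* unit c)         ≡⟨ ×-*-comm c _ _ ⟩
  (c × (m × unit K)) ℚ.* unit c         ≡⟨ cong (ℚ._* unit c) (×-assocˡ (unit K) c m) ⟩
  ((c * m) × unit K) ℚ.* unit c         ≤⟨ ℚP.*-monoʳ-≤-nonNeg (unit c) {{ℚP.normalize-nonNeg 1 c}} (×-monoˡ (unit-nonNeg K) cm≤K) ⟩
  (K × unit K) ℚ.* unit c               ≡⟨ cong (ℚ._* unit c) (×-unit K) ⟩
  1ℚ ℚ.* unit c                         ≡⟨ ℚP.*-identityˡ _ ⟩
  unit c                                ∎
  where open ℚP.≤-Reasoning

-- Approximate equality.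

-- |x - y| ≤ δ as two inequalities, so that averages preserve it by monotonicity alone.
Near : ℚ → ℚ → ℚ → Set
Near δ x y = (x ≤ y + δ) Product.× (y ≤ x + δ)

near-refl : ∀ {δ x} → 0ℚ ≤ δ → Near δ x x
near-refl 0≤δ = +-nonNegˡ 0≤δ , +-nonNegˡ 0≤δ

near-≡ : ∀ {δ x x′ y y′} → x ≡ x′ → y ≡ y′ → Near δ x′ y′ → Near δ x y
near-≡ refl refl x≈y = x≈y

near-sym : ∀ {δ x y} → Near δ x y → Near δ y x
near-sym (p , q) = q , p

near-mono : ∀ {δ δ′ x y} → δ ≤ δ′ → Near δ x y → Near δ′ x y
near-mono {x = x} {y} δ≤δ′ (p , q) =
  ℚP.≤-trans p (ℚP.+-monoʳ-≤ y δ≤δ′) , ℚP.≤-trans q (ℚP.+-monoʳ-≤ x δ≤δ′)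

near-trans : ∀ {δ δ′ x y z} → Near δ x y → Near δ′ y z → Near (δ + δ′) x z
near-trans {δ} {δ′} {x} {y} {z} (p , q) (p′ , q′) =
  (begin
    x              ≤⟨ p ⟩
    y + δ          ≤⟨ ℚP.+-monoˡ-≤ δ p′ ⟩
    (z + δ′) + δ   ≡⟨ ℚP.+-assoc z δ′ δ ⟩
    z + (δ′ + δ)   ≡⟨ cong (z +_) (ℚP.+-comm δ′ δ) ⟩
    z + (δ + δ′)   ∎) ,
  (begin
    z              ≤⟨ q′ ⟩
    y + δ′         ≤⟨ ℚP.+-monoˡ-≤ δ′ q ⟩
    (x + δ) + δ′   ≡⟨ ℚP.+-assoc x δ δ′ ⟩
    x + (δ + δ′)   ∎)
  where open ℚP.≤-Reasoning

-- Averages.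

sum-mono : ∀ {K} {f g : Fin K → ℚ} → (∀ i → f i ≤ g i) → sum f ≤ sum g
sum-mono {zero}  f≤g = ℚP.≤-refl
sum-mono {suc K} f≤g = ℚP.+-mono-≤ (f≤g zero) (sum-mono (f≤g ∘ suc))

avg : ∀ K .{{_ : NonZero K}} → (Fin K → ℚ) → ℚ
avg K f = unit K ℚ.* sum f

avg-cong : ∀ K .{{_ : NonZero K}} {f g : Fin K → ℚ} → (∀ i → f i ≡ g i) → avg K f ≡ avg K g
avg-cong K f≡g = cong (unit K ℚ.*_) (sum-cong-≗ f≡g)

avg-const : ∀ K .{{_ : NonZero K}} x → avg K (λ _ → x) ≡ x
avg-const K x = begin
  unit K ℚ.* sum {K} (λ _ → x)   ≡⟨ cong (unit K ℚ.*_) (sum-replicate K {x}) ⟩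
  unit K ℚ.* (K × x)             ≡⟨ ℚP.*-comm (unit K) (K × x) ⟩
  (K × x) ℚ.* unit K             ≡⟨ ×-*-comm K x (unit K) ⟨
  K × (x ℚ.* unit K)             ≡⟨ cong (K ×_) (ℚP.*-comm x (unit K)) ⟩
  K × (unit K ℚ.* x)             ≡⟨ ×-*-comm K (unit K) x ⟩
  (K × unit K) ℚ.* x             ≡⟨ cong (ℚ._* x) (×-unit K) ⟩
  1ℚ ℚ.* x                       ≡⟨ ℚP.*-identityˡ x ⟩
  x                              ∎
  where open ≡-Reasoning

avg-+ : ∀ K .{{_ : NonZero K}} (f g : Fin K → ℚ) → avg K (λ i → f i + g i) ≡ avg K f + avg K g
avg-+ K f g = trans (cong (unit K ℚ.*_) (∑-distrib-+ f g)) (ℚP.*-distribˡ-+ (unit K) (sum f) (sum g))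

avg-mono : ∀ K .{{_ : NonZero K}} {f g : Fin K → ℚ} → (∀ i → f i ≤ g i) → avg K f ≤ avg K g
avg-mono K f≤g = ℚP.*-monoˡ-≤-nonNeg (unit K) {{ℚP.normalize-nonNeg 1 K}} (sum-mono f≤g)

avg-swap : ∀ K L .{{_ : NonZero K}} .{{_ : NonZero L}} (f : Fin K → Fin L → ℚ) →
           avg K (λ i → avg L (f i)) ≡ avg L (λ j → avg K (λ i → f i j))
avg-swap K L f = begin
  unit K ℚ.* sum (λ i → unit L ℚ.* sum (f i))
    ≡⟨ cong (unit K ℚ.*_) (*-distribˡ-sum (unit L) (λ i → sum (f i))) ⟨
  unit K ℚ.* (unit L ℚ.* sum (λ i → sum (f i)))
    ≡⟨ cong (λ x → unit K ℚ.* (unit L ℚ.* x)) (∑-comm f) ⟩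
  unit K ℚ.* (unit L ℚ.* sum (λ j → sum (λ i → f i j)))
    ≡⟨ solve 3 (λ k l s → k :* (l :* s) := l :* (k :* s)) refl (unit K) (unit L) _ ⟩
  unit L ℚ.* (unit K ℚ.* sum (λ j → sum (λ i → f i j)))
    ≡⟨ cong (unit L ℚ.*_) (*-distribˡ-sum (unit K) (λ j → sum (λ i → f i j))) ⟩
  unit L ℚ.* sum (λ j → unit K ℚ.* sum (λ i → f i j))
    ∎
  where
  open ≡-Reasoning
  open +-*-Solver

avg-near : ∀ K .{{_ : NonZero K}} {δ} {f g : Fin K → ℚ} →
           (∀ i → Near δ (f i) (g i)) → Near δ (avg K f) (avg K g)
avg-near K {δ} f≈g = half (proj₁ ∘ f≈g) , half (proj₂ ∘ f≈g)
  where
  half : ∀ {f g : Fin K → ℚ} → (∀ i → f i ≤ g i + δ) → avg K f ≤ avg K g + δ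
  half {f} {g} f≤g+δ = begin
    avg K f                      ≤⟨ avg-mono K f≤g+δ ⟩
    avg K (λ i → g i + δ)        ≡⟨ avg-+ K g (λ _ → δ) ⟩
    avg K g + avg K (λ _ → δ)    ≡⟨ cong (avg K g +_) (avg-const K δ) ⟩
    avg K g + δ                  ∎
    where open ℚP.≤-Reasoning

-- Test functions and shifts of a uniform variable.

Bounded : ∀ {A : Set} → (A → ℚ) → Set
Bounded f = ∀ a → - 1ℚ ≤ f a Product.× f a ≤ 1ℚ

2ℚ : ℚ
2ℚ = 1ℚ + 1ℚ

bounded-spread : ∀ {x y} → x ≤ 1ℚ → - 1ℚ ≤ y → x ≤ y + 2ℚ
bounded-spread {x} {y} x≤1 -1≤y = ℚP.≤-trans x≤1 (ℚP.+-monoˡ-≤ 2ℚ -1≤y)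

sum-telescope : ∀ K (f : ℕ → ℚ) →
  f 0 + sum {K} (λ i → f (suc (toℕ i))) ≡ sum {K} (λ i → f (toℕ i)) + f K
sum-telescope zero    f = ℚP.+-comm (f 0) 0ℚ
sum-telescope (suc K) f = trans (cong (f 0 +_) (sum-telescope K (f ∘ suc)))
  (sym (ℚP.+-assoc (f 0) _ (f (suc K))))

-- Moving the window by one trades the end term `f 0` for `f K`, and two values of a bounded f
-- differ by at most 2.
sum-shift₁ : ∀ K {f : ℕ → ℚ} → Bounded f →
  Near 2ℚ (sum {K} (λ i → f (suc (toℕ i)))) (sum {K} (λ i → f (toℕ i)))
sum-shift₁ K {f} bf =
  exchange (f 0) (f K) Σf′ Σf (sum-telescope K f) (bounded-spread (proj₂ (bf K)) (proj₁ (bf 0))) ,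
  exchange (f K) (f 0) Σf Σf′
    (trans (ℚP.+-comm (f K) Σf) (trans (sym (sum-telescope K f)) (ℚP.+-comm (f 0) Σf′)))
    (bounded-spread (proj₂ (bf 0)) (proj₁ (bf K)))
  where
  open ℚP.≤-Reasoning
  open +-*-Solver
  Σf Σf′ : ℚ
  Σf  = sum {K} (λ i → f (toℕ i))
  Σf′ = sum {K} (λ i → f (suc (toℕ i)))
  exchange : ∀ a b x y → a + x ≡ y + b → b ≤ a + 2ℚ → x ≤ y + 2ℚ
  exchange a b x y a+x≡y+b b≤a+2 = begin
    x                  ≡⟨ solve 2 (λ a x → x := (a :+ x) :+ (:- a)) refl a x ⟩
    (a + x) - a        ≡⟨ cong (_- a) a+x≡y+b ⟩
    (y + b) - a        ≤⟨ ℚP.+-monoˡ-≤ (- a) (ℚP.+-monoʳ-≤ y b≤a+2) ⟩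
    (y + (a + 2ℚ)) - a ≡⟨ solve 3 (λ a y t → (y :+ (a :+ t)) :+ (:- a) := y :+ t) refl a y 2ℚ ⟩
    y + 2ℚ             ∎

sum-shift : ∀ K s {f : ℕ → ℚ} → Bounded f →
  Near (s × 2ℚ) (sum {K} (λ i → f (s ℕ.+ toℕ i))) (sum {K} (λ i → f (toℕ i)))
sum-shift K zero    bf = near-refl ℚP.≤-refl
sum-shift K (suc s) {f} bf = near-mono (ℚP.≤-reflexive (ℚP.+-comm (s × 2ℚ) 2ℚ)) $
  near-trans (sum-shift K s (bf ∘ suc)) (sum-shift₁ K bf)

-- Each unit of shift changes the sum by at most 2, hence the average by at most 2/K; the hypothesis
-- turns 2s/K into 1/c.
avg-shift : ∀ c K s .{{_ : NonZero c}} .{{_ : NonZero K}} {f : ℕ → ℚ} → Bounded f → c * (s * 2) ℕ.≤ K →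
  Near (unit c) (avg K (λ i → f (s ℕ.+ toℕ i))) (avg K (λ i → f (toℕ i)))
avg-shift c K s {f} bf small = near-mono small′ (scale (sum-shift K s bf))
  where
  scale : ∀ {δ x y} → Near δ x y → Near (unit K ℚ.* δ) (unit K ℚ.* x) (unit K ℚ.* y)
  scale {δ} {x} {y} (p , q) = go p , go q
    where
    go : ∀ {x y} → x ≤ y + δ → unit K ℚ.* x ≤ unit K ℚ.* y + unit K ℚ.* δ
    go {x} {y} x≤y+δ = ℚP.≤-trans (ℚP.*-monoˡ-≤-nonNeg (unit K) {{ℚP.normalize-nonNeg 1 K}} x≤y+δ)
      (ℚP.≤-reflexive (ℚP.*-distribˡ-+ (unit K) y δ))
  small′ : unit K ℚ.* (s × 2ℚ) ≤ unit c
  small′ = begin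
    unit K ℚ.* (s × 2ℚ)       ≡⟨ ℚP.*-comm (unit K) (s × 2ℚ) ⟩
    (s × (2 × 1ℚ)) ℚ.* unit K ≡⟨ cong (ℚ._* unit K) (×-assocˡ 1ℚ s 2) ⟩
    ((s * 2) × 1ℚ) ℚ.* unit K ≡⟨ ×-*-comm (s * 2) 1ℚ (unit K) ⟨
    (s * 2) × (1ℚ ℚ.* unit K) ≡⟨ cong ((s * 2) ×_) (ℚP.*-identityˡ (unit K)) ⟩
    (s * 2) × unit K          ≤⟨ ×-unit-≤ (s * 2) c K small ⟩
    unit c                    ∎
    where open ℚP.≤-Reasoning

-- Finite random experiments.

-- Trees of uniform choices with outcomes at the leaves. Expectations are nested averages, so
-- outcomes in an infinite type such as `List ℕ` need no sum over that type.
data Random (A : Set) : Set where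
  return  : A → Random A
  uniform : ∀ K .{{_ : NonZero K}} → (Fin K → Random A) → Random A

infixl 1 _>>=_

_>>=_ : ∀ {A B : Set} → Random A → (A → Random B) → Random B
return a    >>= h = h a
uniform K k >>= h = uniform K (λ i → k i >>= h)

𝔼 : ∀ {A : Set} → Random A → (A → ℚ) → ℚ
𝔼 (return a)    f = f a
𝔼 (uniform K k) f = avg K (λ i → 𝔼 (k i) f)

Support : ∀ {A : Set} → (A → Set) → Random A → Set
Support P (return a)    = P a
Support P (uniform K k) = ∀ i → Support P (k i)

support-mono : ∀ {A : Set} {P Q : A → Set} d → (∀ a → P a → Q a) → Support P d → Support Q d
support-mono (return a)    P⊆Q Pd = P⊆Q a Pd
support-mono (uniform K k) P⊆Q Pd = λ i → support-mono (k i) P⊆Q (Pd i)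

support->>= : ∀ {A B : Set} {P : A → Set} {Q : B → Set} d {h : A → Random B} →
              Support P d → (∀ a → P a → Support Q (h a)) → Support Q (d >>= h)
support->>= (return a)    Pd Qh = Qh a Pd
support->>= (uniform K k) Pd Qh = λ i → support->>= (k i) (Pd i) Qh

𝔼->>= : ∀ {A B : Set} d (h : A → Random B) f → 𝔼 (d >>= h) f ≡ 𝔼 d (λ a → 𝔼 (h a) f)
𝔼->>= (return a)    h f = refl
𝔼->>= (uniform K k) h f = avg-cong K (λ i → 𝔼->>= (k i) h f)

𝔼-cong : ∀ {A : Set} d {f g : A → ℚ} → (∀ a → f a ≡ g a) → 𝔼 d f ≡ 𝔼 d g
𝔼-cong (return a)    f≡g = f≡g a
𝔼-cong (uniform K k) f≡g = avg-cong K (λ i → 𝔼-cong (k i) f≡g)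

𝔼-const : ∀ {A : Set} (d : Random A) x → 𝔼 d (λ _ → x) ≡ x
𝔼-const (return a)    x = refl
𝔼-const (uniform K k) x = trans (avg-cong K (λ i → 𝔼-const (k i) x)) (avg-const K x)

𝔼-near : ∀ {A : Set} {P : A → Set} d {δ f g} → Support P d →
         (∀ a → P a → Near δ (f a) (g a)) → Near δ (𝔼 d f) (𝔼 d g)
𝔼-near (return a)    Pd f≈g = f≈g a Pd
𝔼-near (uniform K k) Pd f≈g = avg-near K (λ i → 𝔼-near (k i) (Pd i) f≈g)

𝔼-mono : ∀ {A : Set} d {f g : A → ℚ} → (∀ a → f a ≤ g a) → 𝔼 d f ≤ 𝔼 d g
𝔼-mono (return a)    f≤g = f≤g a
𝔼-mono (uniform K k) f≤g = avg-mono K (λ i → 𝔼-mono (k i) f≤g)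

𝔼-bounded : ∀ {A : Set} (d : Random A) {f} → Bounded f → - 1ℚ ≤ 𝔼 d f Product.× 𝔼 d f ≤ 1ℚ
𝔼-bounded d {f} bf = subst (_≤ 𝔼 d f) (𝔼-const d (- 1ℚ)) (𝔼-mono d (proj₁ ∘ bf))
                   , subst (𝔼 d f ≤_) (𝔼-const d 1ℚ) (𝔼-mono d (proj₂ ∘ bf))

-- Sums over subsets and mass functions.

∑-cong : ∀ {N} {f g : Subset N → ℚ} → (∀ S → f S ≡ g S) → ∑ f ≡ ∑ g
∑-cong {zero}  f≡g = f≡g []
∑-cong {suc N} f≡g = cong₂ _+_ (∑-cong (λ S → f≡g (outside ∷ S))) (∑-cong (λ S → f≡g (inside ∷ S)))

∑-+ : ∀ {N} (f g : Subset N → ℚ) → ∑ (λ S → f S + g S) ≡ ∑ f + ∑ g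
∑-+ {zero}  f g = refl
∑-+ {suc N} f g = trans
  (cong₂ _+_ (∑-+ (λ S → f (outside ∷ S)) (λ S → g (outside ∷ S)))
             (∑-+ (λ S → f (inside ∷ S)) (λ S → g (inside ∷ S))))
  (solve 4 (λ a b c d → (a :+ b) :+ (c :+ d) := (a :+ c) :+ (b :+ d)) refl
    (∑ (λ S → f (outside ∷ S))) (∑ (λ S → g (outside ∷ S)))
    (∑ (λ S → f (inside ∷ S))) (∑ (λ S → g (inside ∷ S))))
  where open +-*-Solver

∑-*ˡ : ∀ {N} c (f : Subset N → ℚ) → ∑ (λ S → c ℚ.* f S) ≡ c ℚ.* ∑ f
∑-*ˡ {zero}  c f = refl
∑-*ˡ {suc N} c f = trans
  (cong₂ _+_ (∑-*ˡ c (λ S → f (outside ∷ S))) (∑-*ˡ c (λ S → f (inside ∷ S))))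
  (sym (ℚP.*-distribˡ-+ c _ _))

∑-zero : ∀ N → ∑ {N} (λ _ → 0ℚ) ≡ 0ℚ
∑-zero N = trans (∑-*ˡ {N} 0ℚ (λ _ → 0ℚ)) (ℚP.*-zeroˡ (∑ {N} (λ _ → 0ℚ)))

∑-sum : ∀ {N} K (f : Fin K → Subset N → ℚ) → ∑ (λ S → sum (λ i → f i S)) ≡ sum (λ i → ∑ (f i))
∑-sum {N} zero f = ∑-zero N
∑-sum (suc K) f = trans (∑-+ (f zero) (λ S → sum (λ i → f (suc i) S)))
                        (cong (∑ (f zero) +_) (∑-sum K (f ∘ suc)))

∑-avg : ∀ {N} K .{{_ : NonZero K}} (f : Fin K → Subset N → ℚ) →
        ∑ (λ S → avg K (λ i → f i S)) ≡ avg K (λ i → ∑ (f i))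
∑-avg K f = trans (∑-*ˡ (unit K) (λ S → sum (λ i → f i S))) (cong (unit K ℚ.*_) (∑-sum K f))

𝟙 : ∀ {N} → Subset N → Subset N → ℚ
𝟙 S T = if does (S ≟ₛ T) then 1ℚ else 0ℚ

∑-𝟙 : ∀ {N} (S : Subset N) (g : Subset N → ℚ) → ∑ (λ T → 𝟙 S T ℚ.* g T) ≡ g S
∑-𝟙 []            g = ℚP.*-identityˡ (g [])
∑-𝟙 {suc N} (outside ∷ S) g = trans
  (cong₂ _+_ (∑-𝟙 S (λ T → g (outside ∷ T)))
             (trans (∑-cong (λ T → ℚP.*-zeroˡ (g (inside ∷ T)))) (∑-zero N)))
  (ℚP.+-identityʳ _)
∑-𝟙 {suc N} (inside ∷ S) g = trans
  (cong₂ _+_ (trans (∑-cong (λ T → ℚP.*-zeroˡ (g (outside ∷ T)))) (∑-zero N))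
             (∑-𝟙 S (λ T → g (inside ∷ T))))
  (ℚP.+-identityˡ _)

prob : ∀ {A : Set} {N} → Random A → (A → Subset N) → Subset N → ℚ
prob d h T = 𝔼 d (λ a → 𝟙 (h a) T)

-- Change of variables. With g constantly 1 it gives the total mass, with g an indicator the law of
-- S_I, and with g a sign function the distance of two laws.
∑-prob : ∀ {A : Set} {N} (d : Random A) (h : A → Subset N) g →
         ∑ (λ T → prob d h T ℚ.* g T) ≡ 𝔼 d (g ∘ h)
∑-prob (return a)    h g = ∑-𝟙 (h a) g
∑-prob (uniform K k) h g = begin
  ∑ (λ T → avg K (λ i → prob (k i) h T) ℚ.* g T)   ≡⟨ ∑-cong (λ T → avg-*ʳ (λ i → prob (k i) h T) (g T)) ⟩
  ∑ (λ T → avg K (λ i → prob (k i) h T ℚ.* g T))   ≡⟨ ∑-avg K (λ i T → prob (k i) h T ℚ.* g T) ⟩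
  avg K (λ i → ∑ (λ T → prob (k i) h T ℚ.* g T))   ≡⟨ avg-cong K (λ i → ∑-prob (k i) h g) ⟩
  avg K (λ i → 𝔼 (k i) (g ∘ h))                    ∎
  where
  open ≡-Reasoning
  avg-*ʳ : ∀ f x → avg K f ℚ.* x ≡ avg K (λ i → f i ℚ.* x)
  avg-*ʳ f x = trans (ℚP.*-assoc (unit K) (sum f) x)
    (cong (unit K ℚ.*_) (*-distribʳ-sum x f))

𝟙-nonNeg : ∀ {N} (S T : Subset N) → 0ℚ ≤ 𝟙 S T
𝟙-nonNeg S T with does (S ≟ₛ T)
... | true  = ℚP.nonNegative⁻¹ 1ℚ
... | false = ℚP.≤-refl

𝟙-≢ : ∀ {N} {S T : Subset N} → S ≢ T → 𝟙 S T ≡ 0ℚ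
𝟙-≢ {S = S} {T} S≢T with S ≟ₛ T
... | yes S≡T = contradiction S≡T S≢T
... | no  _   = refl

prob-off-support : ∀ {N} {P : Subset N → Set} d → Support P d →
                   ∀ S → ¬ P S → prob d id S ≡ 0ℚ
prob-off-support {P = P} (return T) PT S ¬PS = 𝟙-≢ (λ T≡S → ¬PS (subst P T≡S PT))
prob-off-support (uniform K k) Pk S ¬PS =
  trans (avg-cong K (λ i → prob-off-support (k i) (Pk i) S ¬PS)) (avg-const K 0ℚ)

law : ∀ {n N} (d : Random (Subset N)) → Support (λ S → ∣ S ∣ ≡ n) d → Distribution n N
law {n} d sized = record
  { pmf     = prob d id
  ; nonneg  = λ S → subst (_≤ prob d id S) (𝔼-const d 0ℚ) (𝔼-mono d (λ T → 𝟙-nonNeg T S))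
  ; total   = trans (∑-cong (λ S → sym (ℚP.*-identityʳ (prob d id S))))
                    (trans (∑-prob d id (λ _ → 1ℚ)) (𝔼-const d 1ℚ))
  ; support = λ S p≢0 → decidable-stable (∣ S ∣ ℕP.≟ n) (λ ∣S∣≢n → p≢0 (prob-off-support d sized S ∣S∣≢n))
  }

orderStatistics-law : ∀ {n N} (d : Random (Subset N)) (sized : Support (λ S → ∣ S ∣ ≡ n) d) I T →
  orderStatistics (law d sized) I T ≡ prob d (λ S → select S I) T
orderStatistics-law d sized I T =
  trans (∑-cong (λ S → if-* (does (select S I ≟ₛ T)) (prob d id S))) (∑-prob d id (λ S → 𝟙 (select S I) T))
  where
  if-* : ∀ b x → (if b then x else 0ℚ) ≡ x ℚ.* (if b then 1ℚ else 0ℚ)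
  if-* true  x = sym (ℚP.*-identityʳ x)
  if-* false x = sym (ℚP.*-zeroʳ x)

-- Total variation through test functions.

-- At 0 either sign would do: what matters is |x| = x · sgn x and |sgn x| ≤ 1.
sgn : ℚ → ℚ
sgn x with ℚP.∣p∣≡p∨∣p∣≡-p x
... | inj₁ _ = 1ℚ
... | inj₂ _ = - 1ℚ

*-sgn : ∀ x → ℚ.∣ x ∣ ≡ x ℚ.* sgn x
*-sgn x with ℚP.∣p∣≡p∨∣p∣≡-p x
... | inj₁ eq = trans eq (sym (ℚP.*-identityʳ x))
... | inj₂ eq = trans eq (solve 1 (λ x → :- x := x :* (:- con 1ℚ)) refl x)
  where open +-*-Solver

sgn-bounded : Bounded sgn
sgn-bounded x with ℚP.∣p∣≡p∨∣p∣≡-p x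
... | inj₁ _ = ℚP.≤-trans (ℚP.nonPositive⁻¹ (- 1ℚ)) (ℚP.nonNegative⁻¹ 1ℚ) , ℚP.≤-refl
... | inj₂ _ = ℚP.≤-refl , ℚP.≤-trans (ℚP.nonPositive⁻¹ (- 1ℚ)) (ℚP.nonNegative⁻¹ 1ℚ)

-- The supremum of 𝔼 f(X) − 𝔼 f(Y) over |f| ≤ 1 is twice the total variation
-- distance; it is attained at the sign of p − q.
dTV-≤ : ∀ {n N δ} (d : Random (Subset N)) (sized : Support (λ S → ∣ S ∣ ≡ n) d) I J →
  (∀ f → Bounded f → Near δ (𝔼 d (λ S → f (select S I))) (𝔼 d (λ S → f (select S J)))) →
  dTV (orderStatistics (law d sized) I) (orderStatistics (law d sized) J) ≤ ½ ℚ.* δ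
dTV-≤ {δ = δ} d sized I J near = ℚP.*-monoˡ-≤-nonNeg ½ (begin
  ∑ (λ T → ℚ.∣ orderStatistics (law d sized) I T - orderStatistics (law d sized) J T ∣)
    ≡⟨ ∑-cong (λ T → cong ℚ.∣_∣ (cong₂ _-_ (orderStatistics-law d sized I T) (orderStatistics-law d sized J T))) ⟩
  ∑ (λ T → ℚ.∣ p T - q T ∣)
    ≡⟨ ∑-cong (λ T → trans (*-sgn (p T - q T)) (solve 3 (λ p q s → (p :- q) :* s := p :* s :+ (:- con 1ℚ) :* (q :* s)) refl (p T) (q T) (σ T))) ⟩
  ∑ (λ T → p T ℚ.* σ T + (- 1ℚ) ℚ.* (q T ℚ.* σ T))
    ≡⟨ ∑-+ (λ T → p T ℚ.* σ T) (λ T → (- 1ℚ) ℚ.* (q T ℚ.* σ T)) ⟩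
  ∑ (λ T → p T ℚ.* σ T) + ∑ (λ T → (- 1ℚ) ℚ.* (q T ℚ.* σ T))
    ≡⟨ cong (∑ (λ T → p T ℚ.* σ T) +_) (∑-*ˡ (- 1ℚ) (λ T → q T ℚ.* σ T)) ⟩
  ∑ (λ T → p T ℚ.* σ T) + (- 1ℚ) ℚ.* ∑ (λ T → q T ℚ.* σ T)
    ≡⟨ cong₂ (λ x y → x + (- 1ℚ) ℚ.* y) (∑-prob d (λ S → select S I) σ) (∑-prob d (λ S → select S J) σ) ⟩
  x + (- 1ℚ) ℚ.* y
    ≤⟨ ℚP.+-monoˡ-≤ _ (proj₁ (near σ (λ T → sgn-bounded (p T - q T)))) ⟩
  (y + δ) + (- 1ℚ) ℚ.* y
    ≡⟨ solve 2 (λ y d → (y :+ d) :+ (:- con 1ℚ) :* y := d) refl y δ ⟩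
  δ ∎)
  where
  open ℚP.≤-Reasoning
  open +-*-Solver
  p q σ : _ → ℚ
  p T = prob d (λ S → select S I) T
  q T = prob d (λ S → select S J) T
  σ T = sgn (p T - q T)
  x y : ℚ
  x = 𝔼 d (λ S → σ (select S I))
  y = 𝔼 d (λ S → σ (select S J))

-- Sets encoded by gaps.

-- A list g₀, g₁, g₂, … of gaps encodes the set {g₀, g₀ + 1 + g₁, …}, which place
-- truncates to its part below N.
place : ∀ N → List ℕ → Subset N
place zero    gs            = []
place (suc N) []            = outside ∷ place N []
place (suc N) (zero  ∷ gs)  = inside  ∷ place N gs
place (suc N) (suc g ∷ gs)  = outside ∷ place N (g ∷ gs)

-- The gaps of S_J, where S has the gaps gs preceded by s positions that are free
-- or hold deleted elements.
merge : ∀ {m} → ℕ → List ℕ → Subset m → List ℕ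
merge s []       J             = []
merge s (g ∷ gs) []            = []
merge s (g ∷ gs) (inside  ∷ J) = s ℕ.+ g ∷ merge 0 gs J
merge s (g ∷ gs) (outside ∷ J) = merge (suc (s ℕ.+ g)) gs J

-- The counter only enters the first kept gap, so raising it by one moves the whole set up by one
-- position.
place-merge-suc : ∀ N s gs {m} (J : Subset m) →
  place (suc N) (merge (suc s) gs J) ≡ outside ∷ place N (merge s gs J)
place-merge-suc N s []       J             = refl
place-merge-suc N s (g ∷ gs) []            = refl
place-merge-suc N s (g ∷ gs) (inside  ∷ J) = refl
place-merge-suc N s (g ∷ gs) (outside ∷ J) = place-merge-suc N (suc (s ℕ.+ g)) gs J

select-place-[] : ∀ N gs → select (place N gs) [] ≡ place N []
select-place-[] zero    gs           = refl
select-place-[] (suc N) []           = cong (outside ∷_) (select-place-[] N [])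
select-place-[] (suc N) (zero  ∷ gs) = cong (outside ∷_) (select-place-[] N gs)
select-place-[] (suc N) (suc g ∷ gs) = cong (outside ∷_) (select-place-[] N (g ∷ gs))

-- Moves selection to the level of gaps, where deleting an element adds its gap and one more
-- position to the next gap.
select-place : ∀ N gs {m} (J : Subset m) → select (place N gs) J ≡ place N (merge 0 gs J)
select-place zero    gs           J             = refl
select-place (suc N) []           J             = cong (outside ∷_) (select-place N [] J)
select-place (suc N) (zero  ∷ gs) []            = cong (outside ∷_) (select-place-[] N gs)
select-place (suc N) (zero  ∷ gs) (inside  ∷ J) = cong (inside ∷_) (select-place N gs J)
-- The deleted element becomes a free position, which `merge` counts.
select-place (suc N) (zero  ∷ gs) (outside ∷ J) =
  trans (cong (outside ∷_) (select-place N gs J)) (sym (place-merge-suc N 0 gs J))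
select-place (suc N) (suc g ∷ gs) []            = cong (outside ∷_) (select-place-[] N (g ∷ gs))
select-place (suc N) (suc g ∷ gs) (inside  ∷ J) = cong (outside ∷_) (select-place N (g ∷ gs) (inside ∷ J))
select-place (suc N) (suc g ∷ gs) (outside ∷ J) =
  trans (cong (outside ∷_) (select-place N (g ∷ gs) (outside ∷ J))) (sym (place-merge-suc N (suc g) gs J))

-- One more than the largest encoded element, hence the least N at which `place` truncates nothing.
span : List ℕ → ℕ
span []       = 0
span (g ∷ gs) = suc g ℕ.+ span gs

∣place∣ : ∀ N gs → span gs ℕ.≤ N → ∣ place N gs ∣ ≡ length gs
∣place∣ zero    []           _             = refl
∣place∣ (suc N) []           _             = ∣place∣ N [] ℕ.z≤n
∣place∣ (suc N) (zero  ∷ gs) (ℕ.s≤s fits)  = cong suc (∣place∣ N gs fits)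
∣place∣ (suc N) (suc g ∷ gs) (ℕ.s≤s fits)  = ∣place∣ N (g ∷ gs) fits

-- Random gaps and the reduction of index sets.

cons : ∀ K .{{_ : NonZero K}} → Random (List ℕ) → Random (List ℕ)
cons K d = uniform K λ g → d >>= λ gs → return (toℕ g ∷ gs)

-- Turns the counter into a shift of the first gap, the form to which `avg-shift` applies.
merge-head : ∀ {m} s g gs (J : Subset m) → merge s (g ∷ gs) J ≡ merge 0 (s ℕ.+ g ∷ gs) J
merge-head s g gs []            = refl
merge-head s g gs (inside  ∷ J) = refl
merge-head s g gs (outside ∷ J) = refl

𝔼-cons : ∀ K .{{_ : NonZero K}} d f →
         𝔼 (cons K d) f ≡ avg K (λ g → 𝔼 d (λ gs → f (toℕ g ∷ gs)))
𝔼-cons K d f = avg-cong K (λ g → 𝔼->>= d (λ gs → return (toℕ g ∷ gs)) f)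

-- { i − 1 : i ∈ J, i ≠ min J }
rest : ∀ {m} → Subset (suc m) → Subset m
rest         (inside  ∷ J)  = J
rest {zero}  (outside ∷ []) = []
rest {suc m} (outside ∷ J)  = outside ∷ rest J

∣rest∣ : ∀ {m} (J : Subset (suc m)) → ∣ J ∣ ≢ 0 → suc ∣ rest J ∣ ≡ ∣ J ∣
∣rest∣         (inside  ∷ J)  J≢0 = refl
∣rest∣ {zero}  (outside ∷ []) J≢0 = contradiction refl J≢0
∣rest∣ {suc m} (outside ∷ J)  J≢0 = ∣rest∣ J J≢0

select-∅ : ∀ {N n} (S : Subset N) (I : Subset n) → ∣ I ∣ ≡ 0 → select S I ≡ ⊥
select-∅ []            I             I≡0 = refl
select-∅ (outside ∷ S) I             I≡0 = cong (outside ∷_) (select-∅ S I I≡0)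
select-∅ (inside  ∷ S) []            I≡0 = cong (outside ∷_) (select-∅ S [] I≡0)
select-∅ (inside  ∷ S) (outside ∷ I) I≡0 = cong (outside ∷_) (select-∅ S I I≡0)

-- Spreading out a set of exponents.

module Construction (c : ℕ) .{{_ : NonZero c}} where

  -- One factor 2 pays for the 2s in `avg-shift`, the other for the initial interval being only half
  -- as long as the power of b. Also b ≥ 3, which `gaps-support` needs.
  b : ℕ
  b = 4 * c

  instance
    b≢0 : NonZero b
    b≢0 = ℕP.m*n≢0 4 c

    b*p≢0 : ∀ {p} .{{_ : NonZero p}} → NonZero (b * p)
    b*p≢0 {p} = ℕP.m*n≢0 b p

  -- Starting with p = bᵉ at the exponent e: one gap g per d ∈ D, with g + 1
  -- uniform in [bᵈ].
  gaps : ∀ {N} p .{{_ : NonZero p}} → Subset N → Random (List ℕ)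
  gaps p []            = return []
  gaps p (outside ∷ D) = gaps (b * p) D
  gaps p (inside  ∷ D) = cons p (gaps (b * p) D)

  p*b*x : ∀ p x → p * (b * x) ≡ b * p * x
  p*b*x p x = trans (sym (ℕP.*-assoc p b x)) (cong (_* x) (ℕP.*-comm p b))

  u : ℚ
  u = unit c

  u≥0 : 0ℚ ≤ u
  u≥0 = unit-nonNeg c

  cons-shift : ∀ {m} K .{{_ : NonZero K}} d s (J : Subset m) {F} → Bounded F → c * (s * 2) ℕ.≤ K →
    Near u (𝔼 (cons K d) (λ gs → F (merge s gs J))) (𝔼 (cons K d) (λ gs → F (merge 0 gs J)))
  cons-shift K d s J {F} bF small = near-≡
    (trans (𝔼-cons K d _) (avg-cong K (λ g → 𝔼-cong d (λ gs → cong F (merge-head s (toℕ g) gs J)))))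
    (𝔼-cons K d _)
    -- Averaging over the later gaps leaves a bounded function of the first gap alone.
    (avg-shift c K s {f = λ t → 𝔼 d (λ gs → F (merge 0 (t ∷ gs) J))} (λ t → 𝔼-bounded d (λ gs → bF _)) small)

  s*b : ∀ s → s * b ≡ (c * (s * 2)) * 2
  s*b s = solve 2 (λ s c → s :* (con 4 :* c) := (c :* (s :* con 2)) :* con 2) refl s c
    where open ℕSolver.+-*-Solver

  -- Only the first gap feels the counter. Exponents missing from D enlarge p, so that gap ranges
  -- over at least p values; if there is no gap, both sides agree.
  gaps-shift : ∀ {N m} p .{{_ : NonZero p}} (D : Subset N) s (J : Subset m) {F} → Bounded F → s * b ℕ.≤ p →
    Near u (𝔼 (gaps p D) (λ gs → F (merge s gs J))) (𝔼 (gaps p D) (λ gs → F (merge 0 gs J)))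
  gaps-shift p []            s J bF small = near-refl u≥0
  gaps-shift p (outside ∷ D) s J bF small =
    gaps-shift (b * p) D s J bF (ℕP.≤-trans small (ℕP.m≤n*m p b))
  gaps-shift p (inside  ∷ D) s J bF small =
    cons-shift p (gaps (b * p) D) s J bF
      (ℕP.≤-trans (ℕP.m≤m*n (c * (s * 2)) 2) (ℕP.≤-trans (ℕP.≤-reflexive (sym (s*b s))) small))

  -- Deleting the element after a gap g < p merges g into the next gap, which is
  -- uniform in an interval at least b times longer.
  gaps-select : ∀ {N m} p .{{_ : NonZero p}} (D : Subset N) → ∣ D ∣ ≡ m → (J : Subset m) → ∀ {F} → Bounded F →
    Near (m × u) (𝔼 (gaps p D) (λ gs → F (merge 0 gs J))) (𝔼 (gaps p (select D J)) F)
  gaps-select p []            refl []            bF = near-refl ℚP.≤-refl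
  gaps-select p (outside ∷ D) ∣D∣≡m J             bF = gaps-select (b * p) D ∣D∣≡m J bF
  gaps-select {m = suc m} p (inside ∷ D) refl (inside ∷ J) bF = near-≡
    (𝔼-cons p (gaps (b * p) D) _)
    (𝔼-cons p (gaps (b * p) (select D J)) _)
    -- A kept element costs nothing; the share u reserved for it is given away.
    (near-mono (ℚP.≤-trans (ℚP.≤-reflexive (sym (ℚP.+-identityˡ (m × u)))) (ℚP.+-monoˡ-≤ (m × u) u≥0))
      (avg-near p (λ g → gaps-select (b * p) D refl J (λ gs → bF (toℕ g ∷ gs)))))
  gaps-select {m = suc m} p (inside ∷ D) refl (outside ∷ J) {F} bF = near-trans
    -- For fixed g the counter is g + 1 ≤ p, and the next gap ranges over at least b p values. The
    -- expectation with counter 0 does not depend on g, so averaging over g leaves it unchanged.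
    (near-≡ (𝔼-cons p (gaps (b * p) D) _) (sym (avg-const p _))
      (avg-near p (λ g → gaps-shift (b * p) D (suc (toℕ g)) J bF
        (ℕP.≤-trans (ℕP.*-monoˡ-≤ b (toℕ<n g)) (ℕP.≤-reflexive (ℕP.*-comm p b))))))
    (gaps-select (b * p) D refl J bF)

  -- Here domination runs backwards: K is at least half of p bᴺ, so the starting point x absorbs the
  -- gaps in front of the first selected element, at cost u each, and their exponents drop out. From
  -- that element on, `gaps-select` applies.
  cons-gaps-select : ∀ {N m} K .{{_ : NonZero K}} p .{{_ : NonZero p}} (D : Subset N) → ∣ D ∣ ≡ m →
    (J : Subset (suc m)) → ∣ J ∣ ≢ 0 → p * b ℕ.^ N ℕ.≤ K * 2 → ∀ {F} → Bounded F →
    Near (m × u) (𝔼 (cons K (gaps p D)) (λ gs → F (merge 0 gs J)))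
                 (𝔼 (cons K (gaps p (select D (rest J)))) F)
  cons-gaps-select {m = m} K p D ∣D∣≡m (inside ∷ J) J≢0 wide bF = near-≡
    (𝔼-cons K (gaps p D) _)
    (𝔼-cons K (gaps p (select D J)) _)
    (avg-near K (λ x → gaps-select p D ∣D∣≡m J (λ gs → bF (toℕ x ∷ gs))))
  cons-gaps-select K p [] refl (outside ∷ []) J≢0 wide bF = contradiction refl J≢0
  cons-gaps-select {suc N} K p (outside ∷ D) ∣D∣≡m J@(outside ∷ _) J≢0 wide bF =
    cons-gaps-select K (b * p) D ∣D∣≡m J J≢0
      (subst (ℕ._≤ K * 2) (p*b*x p (b ℕ.^ N)) wide) bF
  cons-gaps-select {suc N} {suc m} K p (inside ∷ D) refl (outside ∷ J) J≢0 wide {F} bF = near-trans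
    (near-≡ exchange (sym (avg-const p _))
      (avg-near p (λ g → cons-shift K G (suc (toℕ g)) J bF (narrow g))))
    (cons-gaps-select K (b * p) D refl J J≢0
      (subst (ℕ._≤ K * 2) (p*b*x p (b ℕ.^ N)) wide) bF)
    where
    G : Random (List ℕ)
    G = gaps (b * p) D
    -- x and g enter only through x + 1 + g, so g may be fixed first, leaving x as the uniform
    -- variable that is shifted by g + 1.
    exchange : 𝔼 (cons K (cons p G)) (λ gs → F (merge 0 gs (outside ∷ J))) ≡
               avg p (λ g → 𝔼 (cons K G) (λ gs → F (merge (suc (toℕ g)) gs J)))
    exchange = begin
      𝔼 (cons K (cons p G)) (λ gs → F (merge 0 gs (outside ∷ J)))
        ≡⟨ 𝔼-cons K (cons p G) _ ⟩
      avg K (λ x → 𝔼 (cons p G) (λ gs → F (merge (suc (toℕ x)) gs J)))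
        ≡⟨ avg-cong K (λ x → 𝔼-cons p G _) ⟩
      avg K (λ x → avg p (λ g → 𝔼 G (λ gs → F (merge (suc (toℕ x)) (toℕ g ∷ gs) J))))
        ≡⟨ avg-swap K p _ ⟩
      avg p (λ g → avg K (λ x → 𝔼 G (λ gs → F (merge (suc (toℕ x)) (toℕ g ∷ gs) J))))
        ≡⟨ avg-cong p (λ g → avg-cong K (λ x → 𝔼-cong G (λ gs → cong F (swap (toℕ x) (toℕ g) gs)))) ⟩
      avg p (λ g → avg K (λ x → 𝔼 G (λ gs → F (merge (suc (toℕ g)) (toℕ x ∷ gs) J))))
        ≡⟨ avg-cong p (λ g → 𝔼-cons K G _) ⟨
      avg p (λ g → 𝔼 (cons K G) (λ gs → F (merge (suc (toℕ g)) gs J)))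
        ∎
      where
      open ≡-Reasoning
      swap : ∀ x g gs → merge (suc x) (g ∷ gs) J ≡ merge (suc g) (x ∷ gs) J
      swap x g gs = trans (merge-head (suc x) g gs J)
        (trans (cong (λ t → merge 0 (suc t ∷ gs) J) (ℕP.+-comm x g)) (sym (merge-head (suc g) x gs J)))
    -- An exponent has just been consumed, so `wide` contains a further factor b and yields p b ≤
    -- 2K.
    narrow : ∀ g → c * (suc (toℕ g) * 2) ℕ.≤ K
    narrow g = ℕP.*-cancelʳ-≤ _ _ 2 (begin
      c * (suc (toℕ g) * 2) * 2   ≡⟨ s*b (suc (toℕ g)) ⟨
      suc (toℕ g) * b             ≤⟨ ℕP.*-monoˡ-≤ b (toℕ<n g) ⟩
      p * b                       ≤⟨ ℕP.*-monoʳ-≤ p (ℕP.m≤m*n b (b ℕ.^ N) {{ℕP.m^n≢0 b N}}) ⟩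
      p * (b * b ℕ.^ N)           ≤⟨ wide ⟩
      K * 2                       ∎)
      where open ℕP.≤-Reasoning

  -- The gaps are bounded by a geometric sum, at most p (bᴺ - 1) / (b - 1), and b - 1 ≥ 2. Keeping
  -- the term p on the left closes the induction: a new gap turns p into at most 3p ≤ b p.
  gaps-support : ∀ {N} p .{{_ : NonZero p}} (D : Subset N) →
    Support (λ gs → length gs ≡ ∣ D ∣ Product.× span gs * 2 ℕ.+ p ℕ.≤ p * b ℕ.^ N) (gaps p D)
  gaps-support p [] = refl , ℕP.≤-reflexive (sym (ℕP.*-identityʳ p))
  gaps-support {suc N} p (outside ∷ D) =
    support-mono (gaps (b * p) D) weaken (gaps-support (b * p) D)
    where
    weaken : ∀ gs → length gs ≡ ∣ D ∣ Product.× span gs * 2 ℕ.+ b * p ℕ.≤ b * p * b ℕ.^ N →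
      length gs ≡ ∣ D ∣ Product.× span gs * 2 ℕ.+ p ℕ.≤ p * (b * b ℕ.^ N)
    weaken gs (len , fits) = len , (begin
      span gs * 2 ℕ.+ p       ≤⟨ ℕP.+-monoʳ-≤ (span gs * 2) (ℕP.m≤n*m p b) ⟩
      span gs * 2 ℕ.+ b * p   ≤⟨ fits ⟩
      b * p * b ℕ.^ N         ≡⟨ p*b*x p (b ℕ.^ N) ⟨
      p * (b * b ℕ.^ N)       ∎)
      where open ℕP.≤-Reasoning
  gaps-support {suc N} p (inside ∷ D) g =
    support->>= (gaps (b * p) D) (gaps-support (b * p) D) extend
    where
    extend : ∀ gs → length gs ≡ ∣ D ∣ Product.× span gs * 2 ℕ.+ b * p ℕ.≤ b * p * b ℕ.^ N →
      suc (length gs) ≡ suc ∣ D ∣ Product.× (suc (toℕ g) ℕ.+ span gs) * 2 ℕ.+ p ℕ.≤ p * (b * b ℕ.^ N)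
    extend gs (len , fits) = cong suc len , (begin
      (suc (toℕ g) ℕ.+ span gs) * 2 ℕ.+ p   ≤⟨ ℕP.+-monoˡ-≤ p (ℕP.*-monoˡ-≤ 2 (ℕP.+-monoˡ-≤ (span gs) (toℕ<n g))) ⟩
      (p ℕ.+ span gs) * 2 ℕ.+ p             ≡⟨ solve 2 (λ p σ → (p :+ σ) :* con 2 :+ p := σ :* con 2 :+ con 3 :* p) refl p (span gs) ⟩
      span gs * 2 ℕ.+ 3 * p                 ≤⟨ ℕP.+-monoʳ-≤ (span gs * 2) (ℕP.*-monoˡ-≤ p 3≤b) ⟩
      span gs * 2 ℕ.+ b * p                 ≤⟨ fits ⟩
      b * p * b ℕ.^ N                       ≡⟨ p*b*x p (b ℕ.^ N) ⟨
      p * (b * b ℕ.^ N)                     ∎)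
      where
      open ℕP.≤-Reasoning
      open ℕSolver.+-*-Solver
      3≤b : 3 ℕ.≤ b
      3≤b = ℕP.≤-trans (ℕP.n≤1+n 3) (ℕP.m≤m*n 4 c)

  -- Rounded up, so that it is positive even for N = 0 and its double is at least bᴺ.
  radius : ∀ N → ℕ
  radius N = ℕ.⌈ b ℕ.^ N /2⌉

  2radius : ∀ N → b ℕ.^ N ℕ.≤ radius N * 2
  2radius N = begin
    b ℕ.^ N                         ≡⟨ ℕP.⌊n/2⌋+⌈n/2⌉≡n (b ℕ.^ N) ⟨
    ℕ.⌊ b ℕ.^ N /2⌋ ℕ.+ radius N    ≤⟨ ℕP.+-monoˡ-≤ (radius N) (ℕP.⌊n/2⌋≤⌈n/2⌉ (b ℕ.^ N)) ⟩
    radius N ℕ.+ radius N           ≡⟨ cong (radius N ℕ.+_) (ℕP.+-identityʳ (radius N)) ⟨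
    2 * radius N                    ≡⟨ ℕP.*-comm 2 (radius N) ⟩
    radius N * 2                    ∎
    where open ℕP.≤-Reasoning

  radius≢0 : ∀ N → NonZero (radius N)
  radius≢0 N = ℕ.>-nonZero (ℕP.⌈n/2⌉-mono (ℕ.>-nonZero⁻¹ (b ℕ.^ N) {{ℕP.m^n≢0 b N}}))

  positions : ∀ {N} → Subset N → Random (List ℕ)
  positions {N} D = cons (radius N) {{radius≢0 N}} (gaps 1 D)

  spread : ∀ {N} → Subset N → Random (Subset (b ℕ.^ N))
  spread {N} D = positions D >>= λ gs → return (place (b ℕ.^ N) gs)

  -- ⌈bᴺ/2⌉ bounds the smallest element and ⌊bᴺ/2⌋ the span of the gaps, by `gaps-support` at p = 1;
  -- together they make exactly bᴺ, so `place` cuts nothing off.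
  spread-support : ∀ {N} (D : Subset N) → Support (λ S → ∣ S ∣ ≡ suc ∣ D ∣) (spread D)
  spread-support {N} D = support->>= (positions D) positions-support λ gs (len , fits) →
    trans (∣place∣ (b ℕ.^ N) gs fits) len
    where
    positions-support : Support (λ gs → length gs ≡ suc ∣ D ∣ Product.× span gs ℕ.≤ b ℕ.^ N) (positions D)
    positions-support x = support->>= (gaps 1 D) (gaps-support 1 D) λ gs (len , fits) → cong suc len , (begin
      suc (toℕ x) ℕ.+ span gs            ≤⟨ ℕP.+-monoˡ-≤ (span gs) (toℕ<n x) ⟩
      radius N ℕ.+ span gs               ≤⟨ ℕP.+-monoʳ-≤ (radius N) (half gs fits) ⟩
      radius N ℕ.+ ℕ.⌊ b ℕ.^ N /2⌋       ≡⟨ ℕP.+-comm (radius N) _ ⟩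
      ℕ.⌊ b ℕ.^ N /2⌋ ℕ.+ radius N       ≡⟨ ℕP.⌊n/2⌋+⌈n/2⌉≡n (b ℕ.^ N) ⟩
      b ℕ.^ N                            ∎)
      where
      open ℕP.≤-Reasoning
      half : ∀ gs → span gs * 2 ℕ.+ 1 ℕ.≤ 1 * b ℕ.^ N → span gs ℕ.≤ ℕ.⌊ b ℕ.^ N /2⌋
      half gs fits = begin
        span gs                            ≡⟨ ℕP.n≡⌊n+n/2⌋ (span gs) ⟩
        ℕ.⌊ span gs ℕ.+ span gs /2⌋        ≤⟨ ℕP.⌊n/2⌋-mono (begin
          span gs ℕ.+ span gs              ≡⟨ cong (span gs ℕ.+_) (ℕP.+-identityʳ (span gs)) ⟨
          2 * span gs                      ≡⟨ ℕP.*-comm 2 (span gs) ⟩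
          span gs * 2                      ≤⟨ ℕP.m≤m+n (span gs * 2) 1 ⟩
          span gs * 2 ℕ.+ 1                ≤⟨ fits ⟩
          1 * b ℕ.^ N                      ≡⟨ ℕP.*-identityˡ (b ℕ.^ N) ⟩
          b ℕ.^ N                          ∎) ⟩
        ℕ.⌊ b ℕ.^ N /2⌋                    ∎

  spread-select : ∀ {N m} (D : Subset N) → ∣ D ∣ ≡ m → (J : Subset (suc m)) → ∣ J ∣ ≢ 0 → ∀ {F} → Bounded F →
    Near (m × u) (𝔼 (spread D) (λ S → F (select S J))) (𝔼 (spread (select D (rest J))) F)
  spread-select {N} D ∣D∣≡m J J≢0 {F} bF = near-≡
    (trans (𝔼->>= (positions D) _ _) (𝔼-cong (positions D) (λ gs → cong F (select-place (b ℕ.^ N) gs J))))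
    (𝔼->>= (positions (select D (rest J))) _ _)
    (cons-gaps-select (radius N) {{radius≢0 N}} 1 D ∣D∣≡m J J≢0
      (ℕP.≤-trans (ℕP.≤-reflexive (ℕP.*-identityˡ (b ℕ.^ N))) (2radius N)) (λ gs → bF (place (b ℕ.^ N) gs)))

  -- Iterating the construction.

  -- Starting at 0 gives `tower 1` = b⁰ = 1, so n rounds from the empty set reach only height n - 1
  -- of `_↑↑_`.
  tower : ℕ → ℕ
  tower zero    = 0
  tower (suc m) = b ℕ.^ tower m

  tower≡↑↑ : ∀ m → tower (suc m) ≡ b ↑↑ m
  tower≡↑↑ zero    = refl
  tower≡↑↑ (suc m) = cong (b ℕ.^_) (tower≡↑↑ m)

  sample : ∀ m → Random (Subset (tower m))
  sample zero    = return []
  sample (suc m) = sample m >>= spread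

  sample-support : ∀ m → Support (λ S → ∣ S ∣ ≡ m) (sample m)
  sample-support zero    = refl
  sample-support (suc m) = support->>= (sample m) (sample-support m) λ D ∣D∣≡m →
    subst (λ k → Support (λ S → ∣ S ∣ ≡ suc k) (spread D)) ∣D∣≡m (spread-support D)

  -- Induction on m: pass from S_I to the spread of D restricted to `rest I`, replace `rest I` by
  -- `rest J`, and return to S_J.
  sample-indistinguishable : ∀ m (I J : Subset m) → ∣ I ∣ ≡ ∣ J ∣ → ∀ F → Bounded F →
    Near ((m * m) × u) (𝔼 (sample m) (λ S → F (select S I))) (𝔼 (sample m) (λ S → F (select S J)))
  sample-indistinguishable zero    I J I≡J F bF = near-refl ℚP.≤-refl
  sample-indistinguishable (suc m) I J I≡J F bF with ∣ J ∣ ℕP.≟ 0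
  -- A spread set always has a smallest element, so the reduction fails for empty index sets; there
  -- both selections are empty.
  ... | yes J≡0 = near-≡
    (𝔼-cong (sample (suc m)) (λ S → cong F (trans (select-∅ S I (trans I≡J J≡0)) (sym (select-∅ S J J≡0)))))
    refl
    (near-refl (×-nonNeg (suc m * suc m) (unit-nonNeg c)))
  ... | no  J≢0 = near-mono error (near-trans (reduce I (J≢0 ∘ trans (sym I≡J)))
    (near-trans
      (sample-indistinguishable m (rest I) (rest J)
        (ℕP.suc-injective (trans (∣rest∣ I (J≢0 ∘ trans (sym I≡J))) (trans I≡J (sym (∣rest∣ J J≢0)))))
        -- Averaging over the spread gives a bounded test function of D; this is why the induction
        -- quantifies over all F.
        (λ D → 𝔼 (spread D) F) (λ D → 𝔼-bounded (spread D) bF))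
      (near-sym (reduce J J≢0))))
    where
    reduce : ∀ K → ∣ K ∣ ≢ 0 → Near (m × u)
      (𝔼 (sample (suc m)) (λ S → F (select S K)))
      (𝔼 (sample m) (λ D → 𝔼 (spread (select D (rest K))) F))
    reduce K K≢0 = near-≡ (𝔼->>= (sample m) spread _) refl
      (𝔼-near (sample m) (sample-support m) (λ D ∣D∣≡m → spread-select D ∣D∣≡m K K≢0 bF))
    error : m × u + ((m * m) × u + m × u) ≤ (suc m * suc m) × u
    error = begin
      m × u + ((m * m) × u + m × u)       ≡⟨ cong (m × u +_) (×-homo-+ u (m * m) m) ⟨
      m × u + (m * m ℕ.+ m) × u           ≡⟨ ×-homo-+ u m (m * m ℕ.+ m) ⟨
      -- m + m² + m is one less than (m + 1)².
      (m ℕ.+ (m * m ℕ.+ m)) × u           ≤⟨ ×-monoˡ (unit-nonNeg c) (ℕP.≤-trans (ℕP.n≤1+n _) (ℕP.≤-reflexive square)) ⟩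
      (suc m * suc m) × u                 ∎
      where
      open ℚP.≤-Reasoning
      square : suc (m ℕ.+ (m * m ℕ.+ m)) ≡ suc m * suc m
      square = solve 1 (λ m → con 1 :+ (m :+ (m :* m :+ m)) := (con 1 :+ m) :* (con 1 :+ m)) refl m
        where open ℕSolver.+-*-Solver

-- The base of order n²/ε.

↧*floor≤↥ : ∀ p → floor p ℤ.* ℚ.↧ p ℤ.≤ ℚ.↥ p
↧*floor≤↥ p@record{} = [n/d]*d≤n (ℚ.↥ p) (ℚ.↧ p)

-- As the ceiling is - `floor (- p)`, clearing denominators reduces this to `↧*floor≤↥` at - p.
≤-∣ceiling∣ : ∀ p → p ≤ ℤ.+ ℤ.∣ ceiling p ∣ / 1
≤-∣ceiling∣ p@record{} = ℚP.toℚᵘ-cancel-≤ (ℚᵘP.≤-trans (ℚᵘ.*≤* numerators)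
  (ℚᵘP.≤-reflexive (ℚᵘP.≃-sym (ℚP.toℚᵘ-fromℚᵘ (ℚᵘ.mkℚᵘ (ℤ.+ ℤ.∣ ceiling p ∣) 0)))))
  where
  open ℤP.≤-Reasoning
  f : ℤ.ℤ
  f = floor (- p)
  i≤∣i∣ : ∀ i → i ℤ.≤ ℤ.+ ℤ.∣ i ∣
  i≤∣i∣ (ℤ.+ n)    = ℤP.≤-refl
  i≤∣i∣ ℤ.-[1+ n ] = ℤ.-≤+
  f*↧p≤-↥p : f ℤ.* ℚ.↧ p ℤ.≤ ℤ.- ℚ.↥ p
  f*↧p≤-↥p = subst₂ (λ d i → f ℤ.* d ℤ.≤ i) (ℚP.↧-neg p) (ℚP.↥-neg p) (↧*floor≤↥ (- p))
  numerators : ℚ.↥ p ℤ.* ℤ.1ℤ ℤ.≤ ℤ.+ ℤ.∣ ceiling p ∣ ℤ.* ℚ.↧ p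
  numerators = begin
    ℚ.↥ p ℤ.* ℤ.1ℤ                    ≡⟨ ℤP.*-identityʳ (ℚ.↥ p) ⟩
    ℚ.↥ p                             ≡⟨ ℤP.neg-involutive (ℚ.↥ p) ⟨
    ℤ.- (ℤ.- ℚ.↥ p)                   ≤⟨ ℤP.neg-mono-≤ f*↧p≤-↥p ⟩
    ℤ.- (f ℤ.* ℚ.↧ p)                 ≡⟨ ℤP.neg-distribˡ-* f (ℚ.↧ p) ⟩
    ceiling p ℤ.* ℚ.↧ p               ≤⟨ ℤP.*-monoʳ-≤-nonNeg (ℚ.↧ p) (i≤∣i∣ (ceiling p)) ⟩
    ℤ.+ ℤ.∣ ceiling p ∣ ℤ.* ℚ.↧ p     ∎

module _ (n : ℕ) (ε : ℚ) .{{_ : NonZero n}} .{{_ : Positive ε}} where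

  private
    instance
      ε≢0 : ℚ.NonZero ε
      ε≢0 = ℚP.pos⇒nonZero ε

    n² q : ℚ
    n² = ℤ.+ (n * n) / 1
    q  = n² ℚ.÷ ε

    q≤⌈q⌉ : q ≤ ℤ.+ ⌈ n ²/ ε ⌉ / 1
    q≤⌈q⌉ = ≤-∣ceiling∣ q

    q>0 : 0ℚ ℚ.< q
    q>0 = ℚP.positive⁻¹ q {{ℚP.pos*pos⇒pos n² {{ℚP.normalize-pos (n * n) 1 {{_}} {{ℕP.m*n≢0 n n}}}} (ℚ.1/ ε) {{ℚP.1/pos⇒pos ε}}}}

  ⌈²/⌉-nonZero : NonZero ⌈ n ²/ ε ⌉
  ⌈²/⌉-nonZero = ℕ.≢-nonZero λ c≡0 →
    ℚP.<-irrefl refl (ℚP.<-≤-trans q>0 (subst (λ c → q ≤ ℤ.+ c / 1) c≡0 q≤⌈q⌉))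

  -- Inserting ε · ε⁻¹ = 1 brings out n²/ε, which is at most the ceiling.
  n²×unit≤ε : .{{_ : NonZero ⌈ n ²/ ε ⌉}} → (n * n) × unit ⌈ n ²/ ε ⌉ ≤ ε
  n²×unit≤ε = begin
    (n * n) × u                      ≡⟨ ×-as-* (n * n) u ⟩
    n² ℚ.* u                         ≡⟨ cong (ℚ._* u) (ℚP.*-identityʳ n²) ⟨
    (n² ℚ.* 1ℚ) ℚ.* u                ≡⟨ cong (λ x → (n² ℚ.* x) ℚ.* u) (ℚP.*-inverseʳ ε) ⟨
    (n² ℚ.* (ε ℚ.* ℚ.1/ ε)) ℚ.* u    ≡⟨ solve 4 (λ n ε ε⁻¹ u → (n :* (ε :* ε⁻¹)) :* u := (n :* ε⁻¹) :* (ε :* u)) refl n² ε (ℚ.1/ ε) u ⟩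
    q ℚ.* (ε ℚ.* u)                  ≤⟨ ℚP.*-monoʳ-≤-nonNeg (ε ℚ.* u) {{εu≥0}} q≤⌈q⌉ ⟩
    c/1 ℚ.* (ε ℚ.* u)                ≡⟨ solve 3 (λ c ε u → c :* (ε :* u) := ε :* (c :* u)) refl c/1 ε u ⟩
    ε ℚ.* (c/1 ℚ.* u)                ≡⟨ cong (ε ℚ.*_) (×-as-* ⌈ n ²/ ε ⌉ u) ⟨
    ε ℚ.* (⌈ n ²/ ε ⌉ × u)           ≡⟨ cong (ε ℚ.*_) (×-unit ⌈ n ²/ ε ⌉) ⟩
    ε ℚ.* 1ℚ                         ≡⟨ ℚP.*-identityʳ ε ⟩
    ε                                ∎
    where
    open ℚP.≤-Reasoning
    open +-*-Solver
    u c/1 : ℚ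
    u   = unit ⌈ n ²/ ε ⌉
    c/1 = ℤ.+ ⌈ n ²/ ε ⌉ / 1
    εu≥0 : ℚ.NonNegative (ε ℚ.* u)
    εu≥0 = ℚP.nonNeg*nonNeg⇒nonNeg ε {{ℚP.pos⇒nonNeg ε}} u {{ℚP.normalize-nonNeg 1 ⌈ n ²/ ε ⌉}}

-- The OSI distribution.

indistinguishable-distribution : ∀ c .{{_ : NonZero c}} m →
  Σ[ F ∈ Distribution (suc m) ((4 * c) ↑↑ m) ]
    ((I J : Subset (suc m)) → ∣ I ∣ ≡ ∣ J ∣ →
      dTV (orderStatistics F I) (orderStatistics F J) ≤ ½ ℚ.* ((suc m * suc m) × unit c))
indistinguishable-distribution c m = subst
  (λ N → Σ[ F ∈ Distribution (suc m) N ]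
    ((I J : Subset (suc m)) → ∣ I ∣ ≡ ∣ J ∣ →
      dTV (orderStatistics F I) (orderStatistics F J) ≤ ½ ℚ.* ((suc m * suc m) × unit c)))
  (tower≡↑↑ m)
  (law (sample (suc m)) (sample-support (suc m)) , λ I J I≡J →
    dTV-≤ (sample (suc m)) (sample-support (suc m)) I J (sample-indistinguishable (suc m) I J I≡J))
  where open Construction c

½*-≤ : ∀ {x ε} .{{_ : Positive ε}} → x ≤ ε → ½ ℚ.* x ≤ ε
½*-≤ {x} {ε} x≤ε = begin
  ½ ℚ.* x             ≤⟨ ℚP.*-monoˡ-≤-nonNeg ½ x≤ε ⟩
  ½ ℚ.* ε             ≤⟨ +-nonNegˡ (ℚP.≤-trans (ℚP.≤-reflexive (sym (ℚP.*-zeroʳ ½))) (ℚP.*-monoˡ-≤-nonNeg ½ (ℚP.<⇒≤ (ℚP.positive⁻¹ ε)))) ⟩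
  ½ ℚ.* ε + ½ ℚ.* ε   ≡⟨ solve 1 (λ ε → con ½ :* ε :+ con ½ :* ε := ε) refl ε ⟩
  ε                   ∎
  where
  open ℚP.≤-Reasoning
  open +-*-Solver

lemma2p4 : Σ[ C ∈ ℕ ] ((n : ℕ) (ε : ℚ) .{{_ : NonZero n}} .{{_ : Positive ε}} →
    Σ[ F ∈ Distribution n ((C * ⌈ n ²/ ε ⌉) ↑↑ (n ∸ 1)) ]
    ((I J : Subset n) → ∣ I ∣ ≡ ∣ J ∣ →
    dTV (orderStatistics F I) (orderStatistics F J) ≤ ε))
-- C = 4 since b = 4c, with c the ceiling of n²/ε.
lemma2p4 = 4 , λ where
  (suc m) ε →
    let instance c≢0 = ⌈²/⌉-nonZero (suc m) ε
        F , close    = indistinguishable-distribution ⌈ suc m ²/ ε ⌉ m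
    -- The error is even at most ε/2; the factor ½ from the total variation distance is given away.
    in F , λ I J I≡J → ℚP.≤-trans (close I J I≡J) (½*-≤ (n²×unit≤ε (suc m) ε))
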